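{- Let $a=(a_i)_{i\in\mathbb Z}$ be any sequence of complex numbers and let $\mu=(p_1,\dots,p_d\mid q_1,\dots,q_d)$ be a Young diagram in Frobenius notation. Then $s_{\mu;a}=\det[s_{(p_i\mid q_j);a}]_{i,j=1}^d$ (Giambelli formula), where $(p\mid q)$ denotes the hook diagram with Frobenius coordinates $p,q$.
   Context: $\Lambda$ is the algebra of symmetric functions over $\mathbb C$ with complete homogeneous $h_k$ and elementary $e_k$. For a sequence $a=(a_i)_{i\in\mathbb Z}$ define $h_{k;a}=\sum_{i=1}^k(-1)^{k-i}e_{k-i}(a_1,\dots,a_{k-1})h_i$ for $k\ge1$, $h_{0;a}=1$, $h_{k;a}=0$ for $k<0$; let $(\tau^ra)_i=a_{i+r}$; and set $s_{\mu;a}=\det[h_{\mu_i-i+j;\,\tau^{1-j}a}]_{i,j=1}^N$ for any $N\ge\ell(\mu)$. Frobenius notation: a Young diagram $\mu$ with $d$ diagonal boxes is written $(p_1,\dots,p_d\mid q_1,\dots,q_d)$ with $p_i=\mu_i-i$, $q_i=\mu'_i-i$, $\mu'$ the transposed diagram. -}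

module Defs where

open import Algebra.Bundles using (CommutativeRing)
open import Data.Bool.Base using (true; false; if_then_else_)
open import Data.Fin.Base using (Fin; zero; suc; toℕ; fromℕ; inject₁; punchIn)
open import Data.Fin.Properties using (toℕ-fromℕ; toℕ-inject₁; toℕ<n)
open import Data.Integer.Base as ℤ using (ℤ; +_; -[1+_])
import Data.Integer.Properties as ℤ
open import Data.List.Base using (List; []; _∷_; _++_; map; foldr; length; filter; upTo; applyUpTo; replicate)
open import Data.List.Relation.Binary.Permutation.Propositional using (_↭_; prep; swap; ↭-refl)
open import Data.List.Relation.Unary.All as All using (All)
import Data.List.Relation.Unary.All.Properties as All
open import Data.List.Relation.Unary.Linked using (Linked; []; [-]; _∷_)
open import Data.Nat.Base as ℕ using (ℕ; zero; suc; _≤_; _<_; _≥_; _∸_; z≤n; s≤s; _≡ᵇ_)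
open import Data.Nat.ListAction using () renaming (sum to degree)
open import Data.Nat.ListAction.Properties using (sum-↭)
import Data.Nat.Properties as ℕ
open import Data.Product.Base using (∃; _,_)
open import Data.Sum.Base using (_⊎_; inj₁; inj₂)
open import Function.Base using (_∘_; flip)
open import Level using (Level; _⊔_)
open import Relation.Binary.PropositionalEquality.Core as ≡ using (_≡_; cong; cong₂)
open import Relation.Nullary.Decidable.Core using (yes; no)
open import Relation.Nullary.Negation using (contradiction)

private
  variable
    c ℓ : Level

------------------------------------------------------------------------
-- Formal power series in x₁, x₂, x₃, …
--
-- The list α = α₁ ∷ … ∷ αₙ ∷ [] is the exponent vector of the monomial
-- x₁^α₁ ⋯ xₙ^αₙ, and F α is the coefficient of that monomial in F.

module PowerSeries (K : CommutativeRing c ℓ) where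

  open CommutativeRing K
  open import Algebra.Properties.CommutativeSemigroup +-commutativeSemigroup
    using (interchange; x∙yz≈y∙xz)
  open import Relation.Binary.Reasoning.Setoid setoid

  Series : Set c
  Series = List ℕ → Carrier

  -- antidiagonal n f is the sum of f i j over all i, j with i + j = n.
  antidiagonal : ℕ → (ℕ → ℕ → Carrier) → Carrier
  antidiagonal zero    f = f 0 0
  antidiagonal (suc n) f = f 0 (suc n) + antidiagonal n (f ∘ suc)

  -- The coefficient of x^α in F · G: the sum of F β * G γ over all
  -- exponent vectors β, γ of the length of α with β + γ = α.
  conv : Series → Series → Series
  conv F G []      = F [] * G []
  conv F G (n ∷ α) = antidiagonal n λ i j → conv (F ∘ (i ∷_)) (G ∘ (j ∷_)) α

  homogeneousSum : ℕ → Series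
  homogeneousSum k α = if degree α ≡ᵇ k then 1# else 0#

  antidiagonal-cong : ∀ n {f g : ℕ → ℕ → Carrier} →
    (∀ i j → i ℕ.+ j ≡ n → f i j ≈ g i j) → antidiagonal n f ≈ antidiagonal n g
  antidiagonal-cong zero    p = p 0 0 ≡.refl
  antidiagonal-cong (suc n) p =
    +-cong (p 0 (suc n) ≡.refl) (antidiagonal-cong n λ i j e → p (suc i) j (cong suc e))

  antidiagonal-+ : ∀ n (f g : ℕ → ℕ → Carrier) →
    antidiagonal n (λ i j → f i j + g i j) ≈ antidiagonal n f + antidiagonal n g
  antidiagonal-+ zero    f g = refl
  antidiagonal-+ (suc n) f g =
    trans (+-congˡ (antidiagonal-+ n (f ∘ suc) (g ∘ suc))) (interchange _ _ _ _)

  antidiagonal-0 : ∀ n → antidiagonal n (λ _ _ → 0#) ≈ 0#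
  antidiagonal-0 zero    = refl
  antidiagonal-0 (suc n) = trans (+-identityˡ _) (antidiagonal-0 n)

  antidiagonal-swap : ∀ m n (f : ℕ → ℕ → ℕ → ℕ → Carrier) →
    antidiagonal m (λ i j → antidiagonal n (f i j)) ≈
    antidiagonal n (λ k l → antidiagonal m (λ i j → f i j k l))
  antidiagonal-swap zero    n f = refl
  antidiagonal-swap (suc m) n f = begin
    antidiagonal n (f 0 (suc m)) + antidiagonal m (λ i j → antidiagonal n (f (suc i) j))
      ≈⟨ +-congˡ (antidiagonal-swap m n (f ∘ suc)) ⟩
    antidiagonal n (f 0 (suc m)) + antidiagonal n (λ k l → antidiagonal m (λ i j → f (suc i) j k l))
      ≈⟨ antidiagonal-+ n _ _ ⟨
    antidiagonal n (λ k l → antidiagonal (suc m) (λ i j → f i j k l)) ∎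

  antidiagonal-last : ∀ n (f : ℕ → ℕ → Carrier) →
    antidiagonal (suc n) f ≈ f (suc n) 0 + antidiagonal n (λ i j → f i (suc j))
  antidiagonal-last zero    f = +-comm _ _
  antidiagonal-last (suc n) f =
    trans (+-congˡ (antidiagonal-last n (f ∘ suc))) (x∙yz≈y∙xz _ _ _)

  antidiagonal-flip : ∀ n (f : ℕ → ℕ → Carrier) →
    antidiagonal n f ≈ antidiagonal n (flip f)
  antidiagonal-flip zero    f = refl
  antidiagonal-flip (suc n) f =
    trans (+-congˡ (antidiagonal-flip n (f ∘ suc))) (sym (antidiagonal-last n (flip f)))

  antidiagonal-assoc : ∀ n (f : ℕ → ℕ → ℕ → Carrier) →
    antidiagonal n (λ m k → antidiagonal m (λ i j → f i j k)) ≈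
    antidiagonal n (λ i m → antidiagonal m (f i))
  antidiagonal-assoc zero    f = refl
  antidiagonal-assoc (suc n) f = begin
    f 0 0 (suc n) + antidiagonal n (λ m k → f 0 (suc m) k + antidiagonal m (λ i j → f (suc i) j k))
      ≈⟨ +-congˡ (antidiagonal-+ n _ _) ⟩
    f 0 0 (suc n) + (antidiagonal n (λ m k → f 0 (suc m) k) +
      antidiagonal n (λ m k → antidiagonal m (λ i j → f (suc i) j k)))
      ≈⟨ +-assoc _ _ _ ⟨
    antidiagonal (suc n) (f 0) + antidiagonal n (λ m k → antidiagonal m (λ i j → f (suc i) j k))
      ≈⟨ +-congˡ (antidiagonal-assoc n (f ∘ suc)) ⟩
    antidiagonal (suc n) (f 0) + antidiagonal n (λ i m → antidiagonal m (f (suc i))) ∎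

  conv-cong : ∀ {F F′ G G′ : Series} → (∀ α → F α ≈ F′ α) → (∀ α → G α ≈ G′ α) →
    ∀ α → conv F G α ≈ conv F′ G′ α
  conv-cong p q []      = *-cong (p []) (q [])
  conv-cong p q (n ∷ α) =
    antidiagonal-cong n λ i j _ → conv-cong (p ∘ (i ∷_)) (q ∘ (j ∷_)) α

  conv-comm : ∀ (F G : Series) α → conv F G α ≈ conv G F α
  conv-comm F G []      = *-comm _ _
  conv-comm F G (n ∷ α) =
    trans (antidiagonal-cong n λ i j _ → conv-comm (F ∘ (i ∷_)) (G ∘ (j ∷_)) α)
          (antidiagonal-flip n _)

  conv-+ˡ : ∀ (F F′ G : Series) α →
    conv (λ β → F β + F′ β) G α ≈ conv F G α + conv F′ G α
  conv-+ˡ F F′ G []      = distribʳ _ _ _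
  conv-+ˡ F F′ G (n ∷ α) =
    trans (antidiagonal-cong n λ i j _ → conv-+ˡ (F ∘ (i ∷_)) (F′ ∘ (i ∷_)) (G ∘ (j ∷_)) α)
          (antidiagonal-+ n _ _)

  conv-antidiagonalˡ : ∀ n (F : ℕ → ℕ → Series) (G : Series) α →
    conv (λ β → antidiagonal n (λ i j → F i j β)) G α ≈
    antidiagonal n (λ i j → conv (F i j) G α)
  conv-antidiagonalˡ zero    F G α = refl
  conv-antidiagonalˡ (suc n) F G α =
    trans (conv-+ˡ _ _ G α) (+-congˡ (conv-antidiagonalˡ n (F ∘ suc) G α))

  conv-antidiagonalʳ : ∀ n (F : Series) (G : ℕ → ℕ → Series) α →
    conv F (λ β → antidiagonal n (λ i j → G i j β)) α ≈
    antidiagonal n (λ i j → conv F (G i j) α)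
  conv-antidiagonalʳ n F G α = begin
    conv F (λ β → antidiagonal n (λ i j → G i j β)) α  ≈⟨ conv-comm F _ α ⟩
    conv (λ β → antidiagonal n (λ i j → G i j β)) F α  ≈⟨ conv-antidiagonalˡ n G F α ⟩
    antidiagonal n (λ i j → conv (G i j) F α)
      ≈⟨ antidiagonal-cong n (λ i j _ → conv-comm (G i j) F α) ⟩
    antidiagonal n (λ i j → conv F (G i j) α)          ∎

  conv-assoc : ∀ (F G H : Series) α → conv (conv F G) H α ≈ conv F (conv G H) α
  conv-assoc F G H []      = *-assoc _ _ _
  conv-assoc F G H (n ∷ α) = begin
    antidiagonal n (λ m k → conv (λ β → antidiagonal m (λ i j →
      conv (F ∘ (i ∷_)) (G ∘ (j ∷_)) β)) (H ∘ (k ∷_)) α)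
      ≈⟨ antidiagonal-cong n (λ m k _ → conv-antidiagonalˡ m _ _ α) ⟩
    antidiagonal n (λ m k → antidiagonal m (λ i j →
      conv (conv (F ∘ (i ∷_)) (G ∘ (j ∷_))) (H ∘ (k ∷_)) α))
      ≈⟨ antidiagonal-assoc n _ ⟩
    antidiagonal n (λ i m → antidiagonal m (λ j k →
      conv (conv (F ∘ (i ∷_)) (G ∘ (j ∷_))) (H ∘ (k ∷_)) α))
      ≈⟨ antidiagonal-cong n (λ i m _ → antidiagonal-cong m λ j k _ →
           conv-assoc (F ∘ (i ∷_)) (G ∘ (j ∷_)) (H ∘ (k ∷_)) α) ⟩
    antidiagonal n (λ i m → antidiagonal m (λ j k →
      conv (F ∘ (i ∷_)) (conv (G ∘ (j ∷_)) (H ∘ (k ∷_))) α))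
      ≈⟨ antidiagonal-cong n (λ i m _ → conv-antidiagonalʳ m (F ∘ (i ∷_)) _ α) ⟨
    antidiagonal n (λ i m → conv (F ∘ (i ∷_)) (λ β → antidiagonal m (λ j k →
      conv (G ∘ (j ∷_)) (H ∘ (k ∷_)) β)) α) ∎

  conv-vanish : ∀ (F G : Series) α →
    (∀ β γ → degree β ℕ.+ degree γ ≡ degree α → F β * G γ ≈ 0#) → conv F G α ≈ 0#
  conv-vanish F G []      p = p [] [] ≡.refl
  conv-vanish F G (n ∷ α) p =
    trans (antidiagonal-cong n λ i j i+j≡n →
             conv-vanish (F ∘ (i ∷_)) (G ∘ (j ∷_)) α λ β γ e →
               p (i ∷ β) (j ∷ γ) (≡.trans (regroup i (degree β) j (degree γ)) (cong₂ ℕ._+_ i+j≡n e)))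
          (antidiagonal-0 n)
    where
    open import Algebra.Properties.CommutativeSemigroup ℕ.+-commutativeSemigroup
      using () renaming (interchange to regroup)

  conv-identityˡ : ∀ (F : Series) α → conv (homogeneousSum 0) F α ≈ F α
  conv-identityˡ F []          = *-identityˡ _
  conv-identityˡ F (zero ∷ α)  = conv-identityˡ (F ∘ (0 ∷_)) α
  conv-identityˡ F (suc n ∷ α) = begin
    conv (homogeneousSum 0) (F ∘ (suc n ∷_)) α +
      antidiagonal n (λ i j → conv (λ _ → 0#) (F ∘ (j ∷_)) α)
      ≈⟨ +-cong (conv-identityˡ (F ∘ (suc n ∷_)) α)
           (trans (antidiagonal-cong n λ i j _ →
                     conv-vanish (λ _ → 0#) (F ∘ (j ∷_)) α λ _ _ _ → zeroˡ _)
                  (antidiagonal-0 n)) ⟩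
    F (suc n ∷ α) + 0#  ≈⟨ +-identityʳ _ ⟩
    F (suc n ∷ α)       ∎

  conv-↭ : ∀ {F G : Series} →
    (∀ {α β} → α ↭ β → F α ≈ F β) → (∀ {α β} → α ↭ β → G α ≈ G β) →
    ∀ {α β} → α ↭ β → conv F G α ≈ conv F G β
  conv-↭ p q _↭_.refl        = refl
  conv-↭ p q (prep n r)      =
    antidiagonal-cong n λ i j _ → conv-↭ (p ∘ prep i) (q ∘ prep j) r
  conv-↭ {F} {G} p q {α = _ ∷ _ ∷ α} {β = _ ∷ _ ∷ β} (swap m n r) = begin
    antidiagonal m (λ i j → antidiagonal n (λ k l → term i k j l α))
      ≈⟨ antidiagonal-cong m (λ i j _ → antidiagonal-cong n λ k l _ →
           trans (conv-↭ (p ∘ prep i ∘ prep k) (q ∘ prep j ∘ prep l) r)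
                 (conv-cong (λ _ → p (swap i k ↭-refl)) (λ _ → q (swap j l ↭-refl)) β)) ⟩
    antidiagonal m (λ i j → antidiagonal n (λ k l → term k i l j β))
      ≈⟨ antidiagonal-swap m n _ ⟩
    antidiagonal n (λ k l → antidiagonal m (λ i j → term k i l j β)) ∎
    where
    term : ℕ → ℕ → ℕ → ℕ → Series
    term i k j l = conv (λ β → F (i ∷ k ∷ β)) (λ β → G (j ∷ l ∷ β))
  conv-↭ p q (_↭_.trans r s) = trans (conv-↭ p q r) (conv-↭ p q s)

------------------------------------------------------------------------
-- The algebra of symmetric functions over K

module _ (K : CommutativeRing c ℓ) where

  private module K = CommutativeRing K
  open PowerSeries K

  -- Power series of bounded degree, invariant under permutations of the
  -- variables. By stability and symmetry, coefficients do not depend on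
  -- zeros anywhere in the exponent vector; in particular trailing zeros
  -- are irrelevant, so that coeff is well defined on monomials.
  record SymmetricFunction : Set (c ⊔ ℓ) where
    field
      coeff     : List ℕ → K.Carrier
      stable    : ∀ α → coeff (0 ∷ α) K.≈ coeff α
      symmetric : ∀ {α β} → α ↭ β → coeff α K.≈ coeff β
      bounded   : ∃ λ d → ∀ α → d < degree α → coeff α K.≈ K.0#

open SymmetricFunction

module _ (K : CommutativeRing c ℓ) where

  private module K = CommutativeRing K
  open PowerSeries K
  open import Algebra.Properties.AbelianGroup K.+-abelianGroup using (ε⁻¹≈ε)

  private
    Carrier : Set (c ⊔ ℓ)
    Carrier = SymmetricFunction K

    infix  4 _≈_
    infixl 6 _+_
    infixl 7 _*_
    infix  8 -_

    _≈_ : Carrier → Carrier → Set ℓ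
    f ≈ g = ∀ α → coeff f α K.≈ coeff g α

    _+_ : Carrier → Carrier → Carrier
    (f + g) .coeff α = coeff f α K.+ coeff g α
    (f + g) .stable α = K.+-cong (stable f α) (stable g α)
    (f + g) .symmetric p = K.+-cong (symmetric f p) (symmetric g p)
    (f + g) .bounded with bounded f | bounded g
    ... | d , p | e , q = d ℕ.+ e , λ α d+e< → K.trans
      (K.+-cong (p α (ℕ.≤-<-trans (ℕ.m≤m+n d e) d+e<)) (q α (ℕ.≤-<-trans (ℕ.m≤n+m e d) d+e<)))
      (K.+-identityˡ K.0#)

    -_ : Carrier → Carrier
    (- f) .coeff α = K.- coeff f α
    (- f) .stable α = K.-‿cong (stable f α)
    (- f) .symmetric p = K.-‿cong (symmetric f p)
    (- f) .bounded with bounded f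
    ... | d , p = d , λ α d< → K.trans (K.-‿cong (p α d<)) ε⁻¹≈ε

    exceeds : ∀ {d e m n} → d ℕ.+ e < m ℕ.+ n → d < m ⊎ e < n
    exceeds {d} {e} {m} {n} d+e<m+n with d ℕ.<? m | e ℕ.<? n
    ... | yes d<m | _                        = inj₁ d<m
    ... | _                        | yes e<n = inj₂ e<n
    ... | no d≮m  | no e≮n  = contradiction
      (ℕ.+-mono-≤ (ℕ.≮⇒≥ d≮m) (ℕ.≮⇒≥ e≮n)) (ℕ.<⇒≱ d+e<m+n)

    _*_ : Carrier → Carrier → Carrier
    (f * g) .coeff = conv (coeff f) (coeff g)
    (f * g) .stable = conv-cong (stable f) (stable g)
    (f * g) .symmetric = conv-↭ (symmetric f) (symmetric g)
    (f * g) .bounded with bounded f | bounded g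
    ... | d , p | e , q = d ℕ.+ e , λ α d+e< → conv-vanish _ _ α λ β γ β+γ≡α →
      vanish β γ (exceeds (≡.subst (d ℕ.+ e <_) (≡.sym β+γ≡α) d+e<))
      where
      vanish : ∀ β γ → d < degree β ⊎ e < degree γ → coeff f β K.* coeff g γ K.≈ K.0#
      vanish β γ (inj₁ d<) = K.trans (K.*-congʳ (p β d<)) (K.zeroˡ _)
      vanish β γ (inj₂ e<) = K.trans (K.*-congˡ (q γ e<)) (K.zeroʳ _)

    0# : Carrier
    0# .coeff _ = K.0#
    0# .stable _ = K.refl
    0# .symmetric _ = K.refl
    0# .bounded = 0 , λ _ _ → K.refl

  -- The complete homogeneous symmetric function hₖ, the sum of all
  -- monomials of degree k.
  complete : ℕ → SymmetricFunction K
  complete k .coeff = homogeneousSum k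
  complete k .stable _ = K.refl
  complete k .symmetric p = K.reflexive
    (cong (λ n → if n ≡ᵇ k then K.1# else K.0#) (sum-↭ p))
  complete k .bounded = k , λ α → above (degree α)
    where
    above : ∀ n → k < n → (if n ≡ᵇ k then K.1# else K.0#) K.≈ K.0#
    above n k<n with n ≡ᵇ k | ℕ.≡ᵇ⇒≡ n k
    ... | false | _ = K.refl
    ... | true  | e = contradiction (≡.sym (e _)) (ℕ.<⇒≢ k<n)

  infixr 7 _·_
  _·_ : K.Carrier → SymmetricFunction K → SymmetricFunction K
  (x · f) .coeff α = x K.* coeff f α
  (x · f) .stable α = K.*-congˡ (stable f α)
  (x · f) .symmetric p = K.*-congˡ (symmetric f p)
  (x · f) .bounded with bounded f
  ... | d , p = d , λ α d< → K.trans (K.*-congˡ (p α d<)) (K.zeroʳ x)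

  Λ : CommutativeRing (c ⊔ ℓ) ℓ
  Λ = record
    { Carrier = Carrier ; _≈_ = _≈_ ; _+_ = _+_ ; _*_ = _*_ ; -_ = -_
    ; 0# = 0# ; 1# = complete 0
    ; isCommutativeRing = record
      { isRing = record
        { +-isAbelianGroup = record
          { isGroup = record
            { isMonoid = record
              { isSemigroup = record
                { isMagma = record
                  { isEquivalence = record
                    { refl  = λ _ → K.refl
                    ; sym   = λ p α → K.sym (p α)
                    ; trans = λ p q α → K.trans (p α) (q α)
                    }
                  ; ∙-cong = λ p q α → K.+-cong (p α) (q α)
                  }
                ; assoc = λ _ _ _ _ → K.+-assoc _ _ _
                }
              ; identity = (λ _ _ → K.+-identityˡ _) , (λ _ _ → K.+-identityʳ _)
              }
            ; inverse = (λ _ _ → K.-‿inverseˡ _) , (λ _ _ → K.-‿inverseʳ _)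
            ; ⁻¹-cong = λ p α → K.-‿cong (p α)
            }
          ; comm = λ _ _ _ → K.+-comm _ _
          }
        ; *-cong = conv-cong
        ; *-assoc = λ f g h → conv-assoc (coeff f) (coeff g) (coeff h)
        ; *-identity = (λ f → conv-identityˡ (coeff f))
                     , (λ f α → K.trans (conv-comm (coeff f) (homogeneousSum 0) α)
                                        (conv-identityˡ (coeff f) α))
        ; distrib = (λ f g h α → K.trans (conv-comm (coeff f) _ α)
                      (K.trans (conv-+ˡ (coeff g) (coeff h) (coeff f) α)
                        (K.+-cong (conv-comm (coeff g) (coeff f) α)
                                  (conv-comm (coeff h) (coeff f) α))))
                  , (λ f g h → conv-+ˡ (coeff g) (coeff h) (coeff f))
        }
      ; *-comm = λ f g → conv-comm (coeff f) (coeff g)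
      }
    }

------------------------------------------------------------------------
-- Determinants and elementary symmetric polynomials

-- The sublists of length m, each choice of positions occurring once.
sublists : ∀ {A : Set c} → ℕ → List A → List (List A)
sublists zero    _        = [] ∷ []
sublists (suc m) []       = []
sublists (suc m) (x ∷ xs) = map (x ∷_) (sublists m xs) ++ sublists (suc m) xs

module _ (R : CommutativeRing c ℓ) where

  open CommutativeRing R hiding (zero)
  open import Algebra.Properties.Semiring.Exp semiring using (_^_)
  open import Algebra.Properties.Semiring.Sum semiring using (sum-syntax)

  -- Laplace expansion along the first row.
  det : ∀ n → (Fin n → Fin n → Carrier) → Carrier
  det zero    A = 1#
  det (suc n) A = ∑[ j < suc n ]
    ((- 1#) ^ toℕ j * (A zero j * det n λ i k → A (suc i) (punchIn j k)))

  -- eₘ(x₁, …, xₙ)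
  elementary : ℕ → List Carrier → Carrier
  elementary m xs = foldr _+_ 0# (map (foldr _*_ 1#) (sublists m xs))

------------------------------------------------------------------------
-- Young diagrams

record YoungDiagram : Set where
  field
    rows       : List ℕ
    decreasing : Linked _≥_ rows
    positive   : All (0 <_) rows

  depth : ℕ
  depth = length rows

open YoungDiagram

-- Rows and columns are numbered from 0: row μ i is μ_{i+1}, and column μ j
-- is μ′_{j+1}.

nth : List ℕ → ℕ → ℕ
nth []       _       = 0
nth (x ∷ _)  zero    = x
nth (_ ∷ xs) (suc i) = nth xs i

row : YoungDiagram → ℕ → ℕ
row μ = nth (rows μ)

column : YoungDiagram → ℕ → ℕ
column μ j = length (filter (j ℕ.<?_) (rows μ))

-- The number of boxes on the diagonal.
diagonal : YoungDiagram → ℕ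
diagonal μ = length (filter (λ i → i ℕ.<? row μ i) (upTo (depth μ)))

-- The Frobenius coordinates. For a diagonal box no truncation occurs in
-- these subtractions.

arm : (μ : YoungDiagram) → Fin (diagonal μ) → ℕ
arm μ i = row μ (toℕ i) ∸ suc (toℕ i)

leg : (μ : YoungDiagram) → Fin (diagonal μ) → ℕ
leg μ i = column μ (toℕ i) ∸ suc (toℕ i)

-- (p ∣ q) = (p + 1, 1, …, 1) with q ones.
hook : ℕ → ℕ → YoungDiagram
hook p q = record
  { rows       = suc p ∷ replicate q 1
  ; decreasing = linked q
  ; positive   = s≤s z≤n All.∷ All.replicate⁺ q (s≤s z≤n)
  }
  where
  linked : ∀ {x} q → Linked _≥_ (suc x ∷ replicate q 1)
  linked zero    = [-]
  linked (suc q) = s≤s z≤n ∷ linked q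

------------------------------------------------------------------------
-- The functions s_{μ;a}

shift : ∀ {A : Set c} → ℤ → (ℤ → A) → (ℤ → A)
shift r a i = a (i ℤ.+ r)

module _ (K : CommutativeRing c ℓ) where

  open CommutativeRing (Λ K) hiding (zero)
  private module K = CommutativeRing K
  open import Algebra.Properties.Semiring.Exp K.semiring using (_^_)
  open import Algebra.Properties.Semiring.Sum semiring using (sum-syntax)

  -- h k a is h_{k;a}. For k = n + 1 the summation index is i = j + 1, so
  -- that k - i = n - j.
  h : ℤ → (ℤ → K.Carrier) → Carrier
  h (+ zero)  a = 1#
  h (+ suc n) a = ∑[ j < suc n ]
    _·_ K ((K.- K.1#) ^ (n ∸ toℕ j) K.*
           elementary K (n ∸ toℕ j) (applyUpTo (λ m → a (+ suc m)) n))
          (complete K (suc (toℕ j)))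
  h -[1+ _ ]  a = 0#

  -- With 1-based indices the (i, j) entry is h_{μᵢ-i+j; τ^{1-j}a}; here i
  -- and j start from 0.
  jacobiTrudi : (ℤ → K.Carrier) → YoungDiagram → ℕ → ℕ → Carrier
  jacobiTrudi a μ i j = h (+ row μ i ℤ.- + i ℤ.+ + j) (shift (ℤ.- (+ j)) a)

  -- s_{μ;a} computed by a determinant of order N.
  sOfOrder : ℕ → (ℤ → K.Carrier) → YoungDiagram → Carrier
  sOfOrder N a μ = det (Λ K) N λ i j → jacobiTrudi a μ (toℕ i) (toℕ j)

  -- Any N ≥ ℓ(μ) gives the same function: see s-independent below.
  s : (ℤ → K.Carrier) → YoungDiagram → Carrier
  s a μ = sOfOrder (depth μ) a μ

------------------------------------------------------------------------
-- Independence of the order of the determinant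

module _ (R : CommutativeRing c ℓ) where

  open CommutativeRing R hiding (zero)
  open import Algebra.Properties.Semiring.Exp semiring using (_^_)
  open import Algebra.Properties.Semiring.Sum semiring
  open import Relation.Binary.Reasoning.Setoid setoid

  private
    Matrix : ℕ → Set c
    Matrix n = Fin n → Fin n → Carrier

    minor : ∀ {n} → Matrix (suc n) → Fin (suc n) → Matrix n
    minor A j i k = A (suc i) (punchIn j k)

    punchIn-inject₁ : ∀ {n} (j : Fin (suc n)) (k : Fin n) →
      punchIn (inject₁ j) (inject₁ k) ≡ inject₁ (punchIn j k)
    punchIn-inject₁ zero    k       = ≡.refl
    punchIn-inject₁ (suc j) zero    = ≡.refl
    punchIn-inject₁ (suc j) (suc k) = cong suc (punchIn-inject₁ j k)

    punchIn-fromℕ : ∀ {n} (j : Fin (suc n)) → punchIn (inject₁ j) (fromℕ n) ≡ fromℕ (suc n)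
    punchIn-fromℕ zero            = ≡.refl
    punchIn-fromℕ {suc n} (suc j) = cong suc (punchIn-fromℕ j)

  det-cong : ∀ n {A B : Fin n → Fin n → Carrier} → (∀ i j → A i j ≈ B i j) → det R n A ≈ det R n B
  det-cong zero    p = refl
  det-cong (suc n) p = sum-cong-≋ {suc n} λ j →
    *-congˡ {(- 1#) ^ toℕ j} (*-cong (p zero j) (det-cong n λ i k → p (suc i) (punchIn j k)))

  det-zeroRow : ∀ n (A : Fin (suc n) → Fin (suc n) → Carrier) →
    (∀ j → A (fromℕ n) j ≈ 0#) → det R (suc n) A ≈ 0#
  det-zeroRow n A p = trans (sum-cong-≋ (term n A p)) (sum-replicate-zero (suc n))
    where
    term : ∀ n (A : Matrix (suc n)) → (∀ j → A (fromℕ n) j ≈ 0#) → ∀ j →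
      (- 1#) ^ toℕ j * (A zero j * det R n (minor A j)) ≈ 0#
    term zero    A p j = trans (*-congˡ (trans (*-congʳ (p j)) (zeroˡ _))) (zeroʳ _)
    term (suc n) A p j =
      trans (*-congˡ (trans (*-congˡ (det-zeroRow n (minor A j) (p ∘ punchIn j))) (zeroʳ _))) (zeroʳ _)

  det-unitRow : ∀ n (A : Fin (suc n) → Fin (suc n) → Carrier) →
    (∀ j → A (fromℕ n) (inject₁ j) ≈ 0#) → A (fromℕ n) (fromℕ n) ≈ 1# →
    det R (suc n) A ≈ det R n (λ i j → A (inject₁ i) (inject₁ j))
  det-unitRow zero    A p q = begin
    1# * (A zero zero * 1#) + 0#  ≈⟨ +-identityʳ _ ⟩
    1# * (A zero zero * 1#)       ≈⟨ *-identityˡ _ ⟩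
    A zero zero * 1#              ≈⟨ *-identityʳ _ ⟩
    A zero zero                   ≈⟨ q ⟩
    1#                            ∎
  det-unitRow (suc n) A p q = begin
    sum term                                ≈⟨ sum-init-last term ⟩
    sum (term ∘ inject₁) + term (fromℕ (suc n))
      ≈⟨ +-cong (sum-cong-≋ initial) final ⟩
    sum term′ + 0#                          ≈⟨ +-identityʳ _ ⟩
    sum term′                               ∎
    where
    A′ : Matrix (suc n)
    A′ i j = A (inject₁ i) (inject₁ j)

    term : Fin (suc (suc n)) → Carrier
    term j = (- 1#) ^ toℕ j * (A zero j * det R (suc n) (minor A j))

    term′ : Fin (suc n) → Carrier
    term′ j = (- 1#) ^ toℕ j * (A zero (inject₁ j) * det R n (minor A′ j))

    initial : ∀ j → term (inject₁ j) ≈ term′ j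
    initial j = *-cong
      (reflexive (cong ((- 1#) ^_) (toℕ-inject₁ j)))
      (*-congˡ (trans
        (det-unitRow n (minor A (inject₁ j))
          (λ k → trans (reflexive (cong (A _) (punchIn-inject₁ j k))) (p (punchIn j k)))
          (trans (reflexive (cong (A _) (punchIn-fromℕ j))) q))
        (det-cong n λ i k → reflexive (cong (A _) (punchIn-inject₁ j k)))))

    punchIn-last : ∀ {n} (k : Fin n) → punchIn (fromℕ n) k ≡ inject₁ k
    punchIn-last zero    = ≡.refl
    punchIn-last (suc k) = cong suc (punchIn-last k)

    final : term (fromℕ (suc n)) ≈ 0#
    final = trans (*-congˡ (trans (*-congˡ (det-zeroRow n (minor A (fromℕ (suc n))) λ k →
      trans (reflexive (cong (A _) (punchIn-last k))) (p k))) (zeroʳ _))) (zeroʳ _)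

  det-stable : ∀ (M : ℕ → ℕ → Carrier) {l N} → l ≤ N →
    (∀ {i j} → l ≤ i → j < i → M i j ≈ 0#) → (∀ {i} → l ≤ i → M i i ≈ 1#) →
    det R N (λ i j → M (toℕ i) (toℕ j)) ≈ det R l (λ i j → M (toℕ i) (toℕ j))
  det-stable M {l} l≤N below unit = from (ℕ.≤⇒≤′ l≤N)
    where
    step : ∀ n → l ≤ n →
      det R (suc n) (λ i j → M (toℕ i) (toℕ j)) ≈ det R n (λ i j → M (toℕ i) (toℕ j))
    step n l≤n = trans
      (det-unitRow n (λ i j → M (toℕ i) (toℕ j))
        (λ j → below l≤last
          (≡.subst₂ _<_ (≡.sym (toℕ-inject₁ j)) (≡.sym (toℕ-fromℕ n)) (toℕ<n j)))
        (unit l≤last))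
      (det-cong n λ i j → reflexive (cong₂ M (toℕ-inject₁ i) (toℕ-inject₁ j)))
      where
      l≤last : l ≤ toℕ (fromℕ n)
      l≤last = ≡.subst (l ≤_) (≡.sym (toℕ-fromℕ n)) l≤n

    from : ∀ {n} → l ℕ.≤′ n →
      det R n (λ i j → M (toℕ i) (toℕ j)) ≈ det R l (λ i j → M (toℕ i) (toℕ j))
    from (ℕ.≤′-reflexive ≡.refl) = refl
    from (ℕ.≤′-step l≤′n)        = trans (step _ (ℕ.≤′⇒≤ l≤′n)) (from l≤′n)

module _ (K : CommutativeRing c ℓ) (a : ℤ → CommutativeRing.Carrier K) (μ : YoungDiagram) where

  open CommutativeRing (Λ K) using (_≈_; 0#; 1#; refl; reflexive)

  private
    row-beyond : ∀ {i} → depth μ ≤ i → row μ i ≡ 0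
    row-beyond = beyond (rows μ)
      where
      beyond : ∀ xs {i} → length xs ≤ i → nth xs i ≡ 0
      beyond []       _         = ≡.refl
      beyond (x ∷ xs) (s≤s l≤i) = beyond xs l≤i

    index : ∀ {i} j → row μ i ≡ 0 → + row μ i ℤ.- + i ℤ.+ + j ≡ ℤ.- + i ℤ.+ + j
    index {i} j e rewrite e = cong (ℤ._+ + j) (ℤ.+-identityˡ (ℤ.- + i))

    h-negative : ∀ {k} b → k ℤ.< + 0 → h K k b ≈ 0#
    h-negative {+ _}       b (ℤ.+<+ ())
    h-negative { -[1+ _ ]} b _ = refl {0#}

    belowDiagonal : ∀ {i j} → depth μ ≤ i → j < i → jacobiTrudi K a μ i j ≈ 0#
    belowDiagonal {i} {j} l≤i j<i = h-negative _ (≡.subst₂ ℤ._<_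
      (≡.sym (index j (row-beyond l≤i))) (ℤ.+-inverseˡ (+ i))
      (ℤ.+-monoʳ-< (ℤ.- + i) (ℤ.+<+ j<i)))

    onDiagonal : ∀ {i} → depth μ ≤ i → jacobiTrudi K a μ i i ≈ 1#
    onDiagonal {i} l≤i = reflexive (cong (λ k → h K k (shift (ℤ.- + i) a))
      (≡.trans (index i (row-beyond l≤i)) (ℤ.+-inverseˡ (+ i))))

  s-independent : ∀ {N} → depth μ ≤ N → sOfOrder K N a μ ≈ s K a μ
  s-independent l≤N = det-stable (Λ K) (jacobiTrudi K a μ) l≤N belowDiagonal onDiagonal

-- Order the Jacobi–Trudi rows of μ by their index r = μ_i - i + 1 (i from 1).
-- The indices r > 0 are the p_i + 1, and the indices r ≤ 0 are the -m with m
-- in the complement S of {q_1, …, q_d} in {0, …, N - 1}. The rows u_m of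
-- index -m form a unitriangular matrix, so the row of index p + 1 is
-- Σₘ w_p(m) u_m. Expanding the first row of the determinant in this way, the
-- terms with m in S have a repeated row and vanish, while for m = q_j moving
-- u_m to its place among the rows of S costs the sign (-1)^(q_j + j), with j
-- counted from 0, and leaves a determinant of the same kind. This is the
-- Laplace expansion of det[(-1)^(q_j) w_{p_i}(q_j)], and the case d = 1
-- identifies its entries as the hook functions.

module Submission where

open import Defs
open import Algebra.Bundles using (CommutativeRing)
open import Data.Fin.Base using (Fin; zero; suc; toℕ; fromℕ; inject₁; punchIn; _↑ʳ_)
open import Data.Fin.Properties using (toℕ-fromℕ; toℕ-inject₁; toℕ<n)
open import Data.Fin.Relation.Unary.Top using (view; ‵fromℕ; ‵inject₁)
open import Data.Integer.Base as ℤ using (ℤ; +_; -[1+_])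
import Data.Integer.Properties as ℤ
open import Data.List.Base using (List; []; _∷_; applyUpTo; drop; filter; length; upTo)
open import Data.List.Properties using
  (filter-accept; filter-all; filter-none; length-drop; length-filter; length-replicate; length-upTo)
open import Data.List.Relation.Unary.All as All using (All; []; _∷_)
import Data.List.Relation.Unary.All.Properties as All
open import Data.List.Relation.Unary.Linked as Linked using (Linked; []; _∷_)
open import Data.List.Relation.Unary.Linked.Properties using (Linked⇒All)
open import Data.Nat.Base as ℕ using (ℕ; zero; suc; _≤_; _<_; _≥_; _∸_; z≤n; s≤s)
import Data.Nat.Properties as ℕ
open import Data.Product.Base using (∃; _×_; _,_)
open import Data.Vec.Base as Vec using (Vec; []; _∷_; _++_; lookup; insertAt; tabulate)
open import Data.Vec.Properties using (lookup-map; lookup-++ʳ; lookup∘tabulate; map-insertAt)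
open import Function.Base using (_∘_; id)
open import Level using (Level)
open import Relation.Nullary.Decidable.Core using (yes; no)
open import Relation.Nullary.Negation using (contradiction)
open import Relation.Unary using (Pred; Decidable)
open import Relation.Binary.PropositionalEquality as ≡ using (_≡_; _≗_; cong; cong₂)

private
  variable
    c ℓ : Level
    d e m n : ℕ

-- Complementary sequences of natural numbers

-- Split k q S: the values of q, in decreasing order, and the entries of S,
-- in increasing order, together enumerate k, k + 1, … without repetition.
data Split (k : ℕ) : (Fin d → ℕ) → Vec ℕ e → Set where
  none : ∀ {q : Fin 0 → ℕ} → Split k q []
  inS  : ∀ {q : Fin d → ℕ} {S : Vec ℕ e} → Split (suc k) q S → Split k q (k ∷ S)
  inQ  : ∀ {q : Fin (suc d) → ℕ} {S : Vec ℕ e} →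
    q (fromℕ d) ≡ k → Split (suc k) (q ∘ inject₁) S → Split k q S

Split-cong : ∀ {k} {q q′ : Fin d → ℕ} {S : Vec ℕ e} → q ≗ q′ → Split k q S → Split k q′ S
Split-cong p none        = none
Split-cong p (inS σ)     = inS (Split-cong p σ)
Split-cong p (inQ top σ) = inQ (≡.trans (≡.sym (p _)) top) (Split-cong (p ∘ inject₁) σ)

punchIn-inject₁ : ∀ (j : Fin (suc n)) (k : Fin n) →
  punchIn (inject₁ j) (inject₁ k) ≡ inject₁ (punchIn j k)
punchIn-inject₁ zero    k       = ≡.refl
punchIn-inject₁ (suc j) zero    = ≡.refl
punchIn-inject₁ (suc j) (suc k) = cong suc (punchIn-inject₁ j k)

punchIn-fromℕ : ∀ (k : Fin n) → punchIn (fromℕ n) k ≡ inject₁ k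
punchIn-fromℕ zero    = ≡.refl
punchIn-fromℕ (suc k) = cong suc (punchIn-fromℕ k)

punchIn-inject₁-fromℕ : ∀ (j : Fin (suc n)) → punchIn (inject₁ j) (fromℕ n) ≡ fromℕ (suc n)
punchIn-inject₁-fromℕ zero            = ≡.refl
punchIn-inject₁-fromℕ {suc n} (suc j) = cong suc (punchIn-inject₁-fromℕ j)

-- The numbers from `k` up to but excluding `q j` are the `d - j` values of `q` of larger index and
-- the `i` entries of `S` before the insertion point. This count is the equation, from which
-- `Δ-giambelli` gets its sign.
Split-transfer : ∀ {k} {q : Fin (suc d) → ℕ} {S : Vec ℕ e} → Split k q S → ∀ j →
  ∃ λ i → Split k (q ∘ punchIn j) (insertAt S i (q j)) × k ℕ.+ (d ℕ.+ toℕ i) ≡ q j ℕ.+ toℕ j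
Split-transfer {d} {k = k} (inS σ) j with Split-transfer σ j
... | i , σ′ , eq = suc i , inS σ′ ,
  ≡.trans (cong (k ℕ.+_) (ℕ.+-suc d (toℕ i))) (≡.trans (ℕ.+-suc k _) eq)
Split-transfer {d} {k = k} {q} {S} (inQ top σ) j with view j
Split-transfer {d} {k = k} {q} {S} (inQ top σ) _ | ‵fromℕ =
  zero ,
  ≡.subst (λ x → Split k (q ∘ punchIn (fromℕ d)) (x ∷ S)) (≡.sym top)
    (inS (Split-cong (λ i → cong q (≡.sym (punchIn-fromℕ i))) σ)) ,
  cong₂ ℕ._+_ (≡.sym top) (≡.trans (ℕ.+-identityʳ d) (≡.sym (toℕ-fromℕ d)))
Split-transfer {suc d} {k = k} {q} {S} (inQ top σ) _ | ‵inject₁ j with Split-transfer σ j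
... | i , σ′ , eq = i ,
  inQ (≡.trans (cong q (punchIn-inject₁-fromℕ j)) top)
      (Split-cong (λ l → cong q (≡.sym (punchIn-inject₁ j l))) σ′) ,
  ≡.trans (ℕ.+-suc k _) (≡.trans eq (cong (q (inject₁ j) ℕ.+_) (≡.sym (toℕ-inject₁ j))))

Split-[] : ∀ {k} {q : Fin 0 → ℕ} {S : Vec ℕ e} → Split k q S → ∀ i → lookup S i ≡ k ℕ.+ toℕ i
Split-[] (inS σ) zero    = ≡.sym (ℕ.+-identityʳ _)
Split-[] (inS σ) (suc i) = ≡.trans (Split-[] σ i) (≡.sym (ℕ.+-suc _ _))

-- `punchIn` on natural numbers, so that minors can be formed by composing maps of columns that
-- carry no bounds.
punch : ℕ → ℕ → ℕ
punch zero    k       = suc k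
punch (suc j) zero    = zero
punch (suc j) (suc k) = suc (punch j k)

toℕ-punchIn : ∀ (j : Fin (suc n)) k → toℕ (punchIn j k) ≡ punch (toℕ j) (toℕ k)
toℕ-punchIn zero    k       = ≡.refl
toℕ-punchIn (suc j) zero    = ≡.refl
toℕ-punchIn (suc j) (suc k) = cong suc (toℕ-punchIn j k)

-- Determinants by expansion along the first row

module Expansion (R : CommutativeRing c ℓ) where

  open CommutativeRing R hiding (zero)
  open import Algebra.Properties.CommutativeSemigroup *-commutativeSemigroup
    using (x∙yz≈y∙xz; interchange)
  open import Algebra.Properties.CommutativeSemigroup +-commutativeSemigroup using ()
    renaming (x∙yz≈y∙xz to x+[y+z]≈y+[x+z])
  open import Algebra.Properties.Ring ring using (-1*x≈-x; -‿involutive; +-inverseʳ-unique)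
  open import Algebra.Properties.Semiring.Exp semiring using (_^_; ^-homo-*)
  import Algebra.Properties.Semiring.Sum semiring as Sum
  open import Relation.Binary.Reasoning.Setoid setoid

  -- Opacity keeps sums over Fin (suc n) folded, so that their summands can
  -- be inferred.
  opaque
    ∑ : ∀ n → (Fin n → Carrier) → Carrier
    ∑ n = Sum.sum

    syntax ∑ n (λ i → x) = ∑[ i < n ] x

    ∑-sum : ∀ n {f g : Fin n → Carrier} → (∀ i → f i ≈ g i) → ∑ n f ≈ Sum.sum g
    ∑-sum n = Sum.sum-cong-≋ {n}

    ∑-cong : ∀ {n} {f g : Fin n → Carrier} → (∀ i → f i ≈ g i) → ∑ n f ≈ ∑ n g
    ∑-cong {n} = Sum.sum-cong-≋ {n}

    ∑-zero : ∀ {n} {f : Fin n → Carrier} → (∀ i → f i ≈ 0#) → ∑ n f ≈ 0#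
    ∑-zero {n} p = trans (Sum.sum-cong-≋ {n} p) (Sum.sum-replicate-zero n)

    ∑-[] : ∀ {f : Fin 0 → Carrier} → ∑ 0 f ≈ 0#
    ∑-[] = refl

    ∑-∷ : ∀ {n} {f : Fin (suc n) → Carrier} → ∑ (suc n) f ≈ f zero + ∑ n (f ∘ suc)
    ∑-∷ = refl

    ∑-∷ʳ : ∀ {n} {f : Fin (suc n) → Carrier} → ∑ (suc n) f ≈ ∑ n (f ∘ inject₁) + f (fromℕ n)
    ∑-∷ʳ {f = f} = Sum.sum-init-last f

    ∑-+ : ∀ {n} {f g : Fin n → Carrier} → ∑[ i < n ] (f i + g i) ≈ ∑ n f + ∑ n g
    ∑-+ {n} {f} {g} = Sum.∑-distrib-+ f g

    *-∑ : ∀ {n} {x} {f : Fin n → Carrier} → x * ∑ n f ≈ ∑[ i < n ] (x * f i)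
    *-∑ {n} {x} {f} = Sum.*-distribˡ-sum x f

    ∑-* : ∀ {n} {x} {f : Fin n → Carrier} → ∑ n f * x ≈ ∑[ i < n ] (f i * x)
    ∑-* {n} {x} {f} = Sum.*-distribʳ-sum x f

    ∑-swap : ∀ {m n} {f : Fin m → Fin n → Carrier} →
      ∑[ i < m ] ∑[ j < n ] f i j ≈ ∑[ j < n ] ∑[ i < m ] f i j
    ∑-swap {f = f} = Sum.∑-comm f

  sign : ℕ → Carrier
  sign n = (- 1#) ^ n

  Row : Set c
  Row = ℕ → Carrier

  -- The determinant of the columns c 0, …, c (n - 1) of an n-rowed matrix
  -- with infinitely many columns; lengths that are only propositionally
  -- equal do not obstruct comparing two such determinants.
  Δ : Vec Row n → (ℕ → ℕ) → Carrier
  Δ         []       c = 1#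
  Δ {suc n} (r ∷ rs) c =
    ∑[ j < suc n ] (sign (toℕ j) * (r (c (toℕ j)) * Δ rs (c ∘ punch (toℕ j))))

  Δ-det : ∀ (rs : Vec Row n) c → Δ rs c ≈ det R n (λ i j → lookup rs i (c (toℕ j)))
  Δ-det         []       c = refl
  Δ-det {suc n} (r ∷ rs) c = ∑-sum (suc n) λ j → *-congˡ (*-congˡ (trans
    (Δ-det rs (c ∘ punch (toℕ j)))
    (det-cong R n λ i k → reflexive (cong (lookup rs i ∘ c) (≡.sym (toℕ-punchIn j k))))))

  Δ-congᶜ : ∀ (rs : Vec Row n) {c c′} → c ≗ c′ → Δ rs c ≈ Δ rs c′
  Δ-congᶜ         []       p = refl
  Δ-congᶜ {suc n} (r ∷ rs) p = ∑-cong λ j →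
    *-congˡ (*-cong (reflexive (cong r (p (toℕ j)))) (Δ-congᶜ rs (p ∘ punch (toℕ j))))

  -- The factor passes through every minor of the expansion along the first row. The lengths are
  -- equal only propositionally because `Δ-insertAt` compares `suc (m + n)` with `m + suc n`.
  Δ-scale-tail : ∀ (rs : Vec Row m) (ss : Vec Row n) x → m ≡ n →
    (∀ c → Δ rs c ≈ x * Δ ss c) → ∀ r c → Δ (r ∷ rs) c ≈ x * Δ (r ∷ ss) c
  Δ-scale-tail rs ss x ≡.refl p r c = trans (∑-cong λ j → trans
    (*-congˡ (trans (*-congˡ (p _)) (x∙yz≈y∙xz _ _ _))) (x∙yz≈y∙xz _ _ _)) (sym *-∑)

  Δ-linear : ∀ (rs : Vec Row n) c r N (w : Fin N → Carrier) (u : Fin N → Row) →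
    (∀ (j : Fin (suc n)) → r (c (toℕ j)) ≈ ∑[ i < N ] (w i * u i (c (toℕ j)))) →
    Δ (r ∷ rs) c ≈ ∑[ i < N ] (w i * Δ (u i ∷ rs) c)
  Δ-linear {n} rs c r N w u p = begin
    ∑[ j < suc n ] (ε j * (r (c (toℕ j)) * X j))
      ≈⟨ ∑-cong (λ j → begin
           ε j * (r (c (toℕ j)) * X j)
             ≈⟨ *-congˡ (*-congʳ (p j)) ⟩
           ε j * ((∑[ i < N ] (w i * u i (c (toℕ j)))) * X j)
             ≈⟨ *-congˡ (∑-*) ⟩
           ε j * (∑[ i < N ] (w i * u i (c (toℕ j)) * X j))
             ≈⟨ *-∑ ⟩
           ∑[ i < N ] (ε j * (w i * u i (c (toℕ j)) * X j))
             ≈⟨ ∑-cong (λ i → trans (*-congˡ (*-assoc _ _ _)) (x∙yz≈y∙xz _ _ _)) ⟩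
           ∑[ i < N ] (w i * (ε j * (u i (c (toℕ j)) * X j))) ∎) ⟩
    ∑[ j < suc n ] ∑[ i < N ] (w i * (ε j * (u i (c (toℕ j)) * X j)))
      ≈⟨ ∑-swap ⟩
    ∑[ i < N ] ∑[ j < suc n ] (w i * (ε j * (u i (c (toℕ j)) * X j)))
      ≈⟨ ∑-cong (λ i → sym (*-∑)) ⟩
    ∑[ i < N ] (w i * Δ (u i ∷ rs) c) ∎
    where
    ε X : Fin (suc n) → Carrier
    ε j = sign (toℕ j)
    X j = Δ rs (c ∘ punch (toℕ j))

  -- Alternation of the determinant in its rows

  -- The double Laplace expansion along two rows whose products of entries
  -- are given by a; H is the complementary minor.
  twoRows : ℕ → (ℕ → ℕ → Carrier) → ((ℕ → ℕ) → Carrier) → Carrier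
  twoRows n a H = ∑[ j < suc n ] ∑[ k < n ]
    (sign (toℕ j) * (sign (toℕ k) *
      (a (toℕ j) (punch (toℕ j) (toℕ k)) * H (punch (toℕ j) ∘ punch (toℕ k)))))

  products : Row → Row → (ℕ → ℕ) → ℕ → ℕ → Carrier
  products x y c j k = x (c j) * y (c k)

  products-comm : ∀ x y c j k → products x y c j k ≈ products y x c k j
  products-comm x y c j k = *-comm _ _

  Δ-twoRows : ∀ (rs : Vec Row n) x y c →
    Δ (x ∷ y ∷ rs) c ≈ twoRows (suc n) (products x y c) (λ g → Δ rs (c ∘ g))
  Δ-twoRows {n} rs x y c = ∑-cong λ j →
    trans (*-congˡ (*-∑)) (trans (*-∑)
      (∑-cong λ k → *-congˡ
        (trans (x∙yz≈y∙xz _ _ _) (*-congˡ (sym (*-assoc _ _ _))))))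

  twoRows-+ : ∀ n a b H →
    twoRows n a H + twoRows n b H ≈ twoRows n (λ j k → a j k + b j k) H
  twoRows-+ n a b H = trans (sym ∑-+) (∑-cong λ j →
    trans (sym ∑-+) (∑-cong λ k →
      trans (sym (distribˡ _ _ _)) (*-congˡ (trans (sym (distribˡ _ _ _))
        (*-congˡ (sym (distribʳ _ _ _)))))))

  -- Arises from `punch (suc j) ∘ punch (suc k)`, which fixes column 0 and equals
  -- `lift (punch j ∘ punch k)` pointwise.
  lift : (ℕ → ℕ) → ℕ → ℕ
  lift g zero    = zero
  lift g (suc k) = suc (g k)

  lift-cong : ∀ {g g′} → g ≗ g′ → lift g ≗ lift g′
  lift-cong p zero    = ≡.refl
  lift-cong p (suc k) = cong suc (p k)

  -- The terms with j = 0 cancel those with k = 0, and the remaining ones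
  -- form a sum of the same kind.
  twoRows-symmetric : ∀ n {a} H → (∀ j k → a j k ≈ a k j) →
    (∀ {g g′} → g ≗ g′ → H g ≈ H g′) → twoRows n a H ≈ 0#
  twoRows-symmetric zero        H a-sym H-cong = ∑-zero λ _ → ∑-[]
  twoRows-symmetric (suc n) {a} H a-sym H-cong = begin
    twoRows (suc n) a H
      ≈⟨ trans ∑-∷ (+-congˡ (∑-cong λ _ → ∑-∷)) ⟩
    ∑ (suc n) first + ∑[ j < suc n ] (t j + ∑ n (rest j))
      ≈⟨ +-congˡ ∑-+ ⟩
    ∑ (suc n) first + (∑ (suc n) t + ∑[ j < suc n ] ∑ n (rest j))
      ≈⟨ +-assoc _ _ _ ⟨
    (∑ (suc n) first + ∑ (suc n) t) + ∑[ j < suc n ] ∑ n (rest j)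
      ≈⟨ +-cong (trans (sym ∑-+)
           (∑-zero cancel))
           (trans (∑-cong λ j → ∑-cong (rest≈ j))
             (twoRows-symmetric n (H ∘ lift) (λ j k → a-sym (suc j) (suc k))
               (H-cong ∘ lift-cong))) ⟩
    0# + 0#
      ≈⟨ +-identityˡ 0# ⟩
    0# ∎
    where
    term : ℕ → ℕ → Carrier
    term j k = sign j * (sign k * (a j (punch j k) * H (punch j ∘ punch k)))

    first t : Fin (suc n) → Carrier
    first k = term 0 (toℕ k)
    t j = term (suc (toℕ j)) 0

    rest : Fin (suc n) → Fin n → Carrier
    rest j k = term (suc (toℕ j)) (suc (toℕ k))

    -- The column pairs `(0, k + 1)` and `(k + 1, 0)` leave the same complementary minor and carry
    -- opposite signs.
    cancel : ∀ k → first k + t k ≈ 0#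
    cancel k = begin
      1# * (sign (toℕ k) * z) + - 1# * sign (toℕ k) * (1# * (a (suc (toℕ k)) 0 * H _))
        ≈⟨ +-cong (*-identityˡ _) (begin
             - 1# * sign (toℕ k) * (1# * (a (suc (toℕ k)) 0 * H _))
               ≈⟨ *-congˡ (trans (*-identityˡ _) (*-congʳ (a-sym _ _))) ⟩
             - 1# * sign (toℕ k) * z   ≈⟨ *-assoc _ _ _ ⟩
             - 1# * (sign (toℕ k) * z) ≈⟨ -1*x≈-x _ ⟩
             - (sign (toℕ k) * z)      ∎) ⟩
      sign (toℕ k) * z + - (sign (toℕ k) * z)
        ≈⟨ -‿inverseʳ _ ⟩
      0# ∎
      where
      z : Carrier
      z = a 0 (suc (toℕ k)) * H (suc ∘ punch (toℕ k))

    -1*-1 : ∀ x y → (- 1# * x) * (- 1# * y) ≈ x * y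
    -1*-1 x y = begin
      (- 1# * x) * (- 1# * y) ≈⟨ interchange _ _ _ _ ⟩
      (- 1# * - 1#) * (x * y) ≈⟨ *-congʳ (trans (-1*x≈-x _) (-‿involutive 1#)) ⟩
      1# * (x * y)            ≈⟨ *-identityˡ _ ⟩
      x * y                   ∎

    rest≈ : ∀ j k → rest j k ≈ sign (toℕ j) * (sign (toℕ k) *
      (a (suc (toℕ j)) (suc (punch (toℕ j) (toℕ k))) * H (lift (punch (toℕ j) ∘ punch (toℕ k)))))
    rest≈ j k = trans (sym (*-assoc _ _ _)) (trans (*-cong (-1*-1 _ _)
      (*-congˡ (H-cong λ { zero → ≡.refl ; (suc _) → ≡.refl }))) (*-assoc _ _ _))

  -- Equal rows make the products symmetric in the two columns. Deducing this from `Δ-swap` would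
  -- require cancelling 2.
  Δ-repeat₂ : ∀ (rs : Vec Row n) x c → Δ (x ∷ x ∷ rs) c ≈ 0#
  Δ-repeat₂ {n} rs x c = trans (Δ-twoRows rs x x c)
    (twoRows-symmetric (suc n) _ (products-comm x x c) (λ p → Δ-congᶜ rs (cong c ∘ p)))

  -- The products for the two orders of `x` and `y` add up to a symmetric function of the columns,
  -- so the sum of the two determinants vanishes.
  Δ-swap : ∀ (rs : Vec Row n) x y c → Δ (x ∷ y ∷ rs) c ≈ - 1# * Δ (y ∷ x ∷ rs) c
  Δ-swap {n} rs x y c = trans (+-inverseʳ-unique _ _ (begin
    Δ (y ∷ x ∷ rs) c + Δ (x ∷ y ∷ rs) c
      ≈⟨ +-cong (Δ-twoRows rs y x c) (Δ-twoRows rs x y c) ⟩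
    twoRows (suc n) (products y x c) H + twoRows (suc n) (products x y c) H
      ≈⟨ twoRows-+ (suc n) (products y x c) (products x y c) H ⟩
    twoRows (suc n) (λ j k → products y x c j k + products x y c j k) H
      ≈⟨ twoRows-symmetric (suc n) H
           (λ j k → trans (+-cong (products-comm y x c j k) (products-comm x y c j k)) (+-comm _ _))
           (λ p → Δ-congᶜ rs (cong c ∘ p)) ⟩
    0# ∎)) (sym (-1*x≈-x _))
    where
    H : (ℕ → ℕ) → Carrier
    H g = Δ rs (c ∘ g)

  Δ-repeat : ∀ (rs : Vec Row n) i c → Δ (lookup rs i ∷ rs) c ≈ 0#
  Δ-repeat (r ∷ rs) zero    c = Δ-repeat₂ rs r c
  Δ-repeat (r ∷ rs) (suc i) c = begin
    Δ (lookup rs i ∷ r ∷ rs) c               ≈⟨ Δ-swap rs (lookup rs i) r c ⟩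
    - 1# * Δ (r ∷ lookup rs i ∷ rs) c
      ≈⟨ *-congˡ (Δ-scale-tail (lookup rs i ∷ rs) (lookup rs i ∷ rs) 0# ≡.refl
           (λ c′ → trans (Δ-repeat rs i c′) (sym (zeroˡ _))) r c) ⟩
    - 1# * (0# * Δ (r ∷ lookup rs i ∷ rs) c) ≈⟨ *-congˡ (zeroˡ _) ⟩
    - 1# * 0#                                ≈⟨ zeroʳ _ ⟩
    0#                                       ∎

  Δ-insert-∷ : ∀ (rs : Vec Row m) (ss : Vec Row n) x k → suc m ≡ n →
    (∀ c → Δ (x ∷ rs) c ≈ sign k * Δ ss c) →
    ∀ r c → Δ (x ∷ r ∷ rs) c ≈ sign (suc k) * Δ (r ∷ ss) c
  Δ-insert-∷ rs ss x k eq p r c = begin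
    Δ (x ∷ r ∷ rs) c                ≈⟨ Δ-swap rs x r c ⟩
    - 1# * Δ (r ∷ x ∷ rs) c         ≈⟨ *-congˡ (Δ-scale-tail (x ∷ rs) ss (sign k) eq p r c) ⟩
    - 1# * (sign k * Δ (r ∷ ss) c)  ≈⟨ *-assoc _ _ _ ⟨
    - 1# * sign k * Δ (r ∷ ss) c    ∎

  -- `x` passes the `m` rows of `rs` and the first `i` rows of `ss`, and each exchange of neighbours
  -- contributes `- 1#`.
  Δ-insertAt : ∀ (rs : Vec Row m) (ss : Vec Row n) i x c →
    Δ (x ∷ rs ++ ss) c ≈ sign (m ℕ.+ toℕ i) * Δ (rs ++ insertAt ss i x) c
  Δ-insertAt []       ss       zero    x c = sym (*-identityˡ _)
  Δ-insertAt []       (s ∷ ss) (suc i) x c =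
    Δ-insert-∷ ss (insertAt ss i x) x (toℕ i) ≡.refl (Δ-insertAt [] ss i x) s c
  Δ-insertAt {m = suc m} {n} (r ∷ rs) ss i x c =
    Δ-insert-∷ (rs ++ ss) (rs ++ insertAt ss i x) x (m ℕ.+ toℕ i)
      (≡.sym (ℕ.+-suc m n)) (Δ-insertAt rs ss i x) r c

  -- Unitriangular expansion and the Giambelli determinant

  Split-sum : ∀ {k} {q : Fin d → ℕ} {S : Vec ℕ e} → Split k q S → ∀ (f : ℕ → Carrier) →
    ∑[ i < d ℕ.+ e ] f (k ℕ.+ toℕ i) ≈ ∑[ i < e ] f (lookup S i) + ∑[ j < d ] f (q j)
  Split-sum none f = trans ∑-[] (sym (trans (+-cong ∑-[] ∑-[]) (+-identityˡ 0#)))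
  Split-sum {d} {suc e} {k} {q} {_ ∷ S} (inS σ) f = begin
    total (d ℕ.+ suc e)                        ≡⟨ cong total (ℕ.+-suc d e) ⟩
    total (suc (d ℕ.+ e))                      ≈⟨ ∑-∷ ⟩
    f (k ℕ.+ 0) + ∑[ i < d ℕ.+ e ] f (k ℕ.+ suc (toℕ i))
      ≈⟨ +-cong (reflexive (cong f (ℕ.+-identityʳ k)))
           (∑-cong λ i → reflexive (cong f (ℕ.+-suc k (toℕ i)))) ⟩
    f k + ∑[ i < d ℕ.+ e ] f (suc k ℕ.+ toℕ i) ≈⟨ +-congˡ (Split-sum σ f) ⟩
    f k + (∑[ i < e ] f (lookup S i) + ∑[ j < d ] f (q j))
      ≈⟨ +-assoc _ _ _ ⟨
    f k + ∑[ i < e ] f (lookup S i) + ∑[ j < d ] f (q j)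
      ≈⟨ +-congʳ ∑-∷ ⟨
    ∑[ i < suc e ] f (lookup (k ∷ S) i) + ∑[ j < d ] f (q j) ∎
    where
    total : ℕ → Carrier
    total n = ∑[ i < n ] f (k ℕ.+ toℕ i)
  Split-sum {suc d} {e} {k} {q} {S} (inQ top σ) f = begin
    ∑[ i < suc d ℕ.+ e ] f (k ℕ.+ toℕ i) ≈⟨ ∑-∷ ⟩
    f (k ℕ.+ 0) + ∑[ i < d ℕ.+ e ] f (k ℕ.+ suc (toℕ i))
      ≈⟨ +-cong (reflexive (cong f (≡.trans (ℕ.+-identityʳ k) (≡.sym top))))
           (∑-cong λ i → reflexive (cong f (ℕ.+-suc k (toℕ i)))) ⟩
    f (q (fromℕ d)) + ∑[ i < d ℕ.+ e ] f (suc k ℕ.+ toℕ i) ≈⟨ +-congˡ (Split-sum σ f) ⟩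
    f (q (fromℕ d)) + (∑[ i < e ] f (lookup S i) + ∑[ j < d ] f (q (inject₁ j)))
      ≈⟨ x+[y+z]≈y+[x+z] _ _ _ ⟩
    ∑[ i < e ] f (lookup S i) + (f (q (fromℕ d)) + ∑[ j < d ] f (q (inject₁ j)))
      ≈⟨ +-congˡ (trans (+-comm _ _) (sym ∑-∷ʳ)) ⟩
    ∑[ i < e ] f (lookup S i) + ∑[ j < suc d ] f (q j) ∎

  -- Forward substitution for the unitriangular system x = Σₘ coord x u m · u m.
  coord : Row → (ℕ → Row) → ℕ → Carrier
  coord x u zero    = x 0
  coord x u (suc m) = coord (λ j → x (suc j) - x 0 * u 0 (suc j)) (λ m j → u (suc m) (suc j)) m

  -- Column 0 meets only `u 0`, with entry 1, so the first coefficient is `x 0`; subtracting `x 0`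
  -- times `u 0` leaves the same problem without row 0 and column 0. The coefficients do not depend
  -- on `N`, so determinants of different orders share them.
  coord-expansion : ∀ x u → (∀ {m j} → j < m → u m j ≈ 0#) → (∀ m → u m m ≈ 1#) →
    ∀ N (j : Fin N) → x (toℕ j) ≈ ∑[ m < N ] (coord x u (toℕ m) * u (toℕ m) (toℕ j))
  coord-expansion x u below unit (suc N) zero = sym (begin
    ∑[ m < suc N ] (coord x u (toℕ m) * u (toℕ m) 0)
      ≈⟨ ∑-∷ ⟩
    x 0 * u 0 0 + ∑[ m < N ] (coord x u (suc (toℕ m)) * u (suc (toℕ m)) 0)
      ≈⟨ +-cong (trans (*-congˡ (unit 0)) (*-identityʳ _))
           (∑-zero λ m → trans (*-congˡ (below (s≤s z≤n))) (zeroʳ _)) ⟩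
    x 0 + 0#  ≈⟨ +-identityʳ _ ⟩
    x 0       ∎)
  coord-expansion x u below unit (suc N) (suc j) = sym (begin
    ∑[ m < suc N ] (coord x u (toℕ m) * u (toℕ m) (suc (toℕ j)))
      ≈⟨ ∑-∷ ⟩
    y + ∑[ m < N ] (coord x u (suc (toℕ m)) * u (suc (toℕ m)) (suc (toℕ j)))
      ≈⟨ +-congˡ (sym (coord-expansion (λ j → x (suc j) - x 0 * u 0 (suc j))
           (λ m j → u (suc m) (suc j)) (below ∘ s≤s) (unit ∘ suc) N j)) ⟩
    y + (x (suc (toℕ j)) - y)    ≈⟨ +-congˡ (+-comm _ _) ⟩
    y + (- y + x (suc (toℕ j)))  ≈⟨ +-assoc _ _ _ ⟨
    y - y + x (suc (toℕ j))      ≈⟨ +-congʳ (-‿inverseʳ y) ⟩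
    0# + x (suc (toℕ j))         ≈⟨ +-identityˡ _ ⟩
    x (suc (toℕ j))              ∎)
    where
    y : Carrier
    y = x 0 * u 0 (suc (toℕ j))

  -- By `schur-hook` this is the function of the hook with arm `p` and leg `q`.
  hookEntry : (ℕ → Row) → (ℕ → Row) → ℕ → ℕ → Carrier
  hookEntry v u p q = sign q * coord (v p) u q

  module _ (v u : ℕ → Row)
    (below : ∀ {m j} → j < m → u m j ≈ 0#) (unit : ∀ m → u m m ≈ 1#) where

    Δ-giambelli : ∀ (p q : Fin d → ℕ) {S : Vec ℕ e} → Split 0 q S →
      Δ (tabulate (v ∘ p) ++ Vec.map u S) id ≈ det R d (λ i j → hookEntry v u (p i) (q j))
    Δ-giambelli {zero} {e} p q {S} σ = begin
      Δ (Vec.map u S) id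
        ≈⟨ Δ-det (Vec.map u S) id ⟩
      det R e (λ i j → lookup (Vec.map u S) i (toℕ j))
        ≈⟨ det-cong R e (λ i j → reflexive (cong (λ r → r (toℕ j))
             (≡.trans (lookup-map i u S) (cong u (Split-[] σ i))))) ⟩
      det R e (λ i j → u (toℕ i) (toℕ j))
        ≈⟨ det-stable R u {N = e} z≤n (λ _ → below) (λ _ → unit _) ⟩
      1# ∎
    Δ-giambelli {suc d} {e} p q {S} σ = begin
      Δ (v (p zero) ∷ rows) id
        -- As many rows `u m` are taken as the determinant has columns, so the expansion is valid in
        -- all of them.
        ≈⟨ Δ-linear rows id (v (p zero)) (suc d ℕ.+ e) (w ∘ toℕ) (u ∘ toℕ)
             (coord-expansion (v (p zero)) u below unit (suc d ℕ.+ e)) ⟩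
      ∑[ m < suc d ℕ.+ e ] f (toℕ m)
        ≈⟨ Split-sum σ f ⟩
      ∑[ i < e ] f (lookup S i) + ∑[ j < suc d ] f (q j)
        ≈⟨ +-cong (∑-zero vanish)
                  (∑-sum (suc d) term) ⟩
      0# + det R (suc d) (λ i j → hookEntry v u (p i) (q j))
        ≈⟨ +-identityˡ _ ⟩
      det R (suc d) (λ i j → hookEntry v u (p i) (q j)) ∎
      where
      arms : Vec Row d
      arms = tabulate (v ∘ p ∘ suc)

      rows : Vec Row (d ℕ.+ e)
      rows = arms ++ Vec.map u S

      w f : ℕ → Carrier
      w = coord (v (p zero)) u
      f m = w m * Δ (u m ∷ rows) id

      vanish : ∀ i → f (lookup S i) ≈ 0#
      vanish i = trans (*-congˡ (trans
        (reflexive (cong (λ r → Δ (r ∷ rows) id) (≡.sym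
          (≡.trans (lookup-++ʳ arms (Vec.map u S) i) (lookup-map i u S)))))
        (Δ-repeat rows (d ↑ʳ i) id))) (zeroʳ _)

      term : ∀ j → f (q j) ≈ sign (toℕ j) * (hookEntry v u (p zero) (q j) *
        det R d (λ i k → hookEntry v u (p (suc i)) (q (punchIn j k))))
      term j with Split-transfer σ j
      ... | i , σ′ , d+i≡q+j = begin
        w (q j) * Δ (u (q j) ∷ rows) id
          ≈⟨ *-congˡ (Δ-insertAt arms (Vec.map u S) i (u (q j)) id) ⟩
        w (q j) * (sign (d ℕ.+ toℕ i) * Δ (arms ++ insertAt (Vec.map u S) i (u (q j))) id)
          -- The number `d + i` of rows passed equals `q j + j`, so the sign factors into that of
          -- `hookEntry` and the Laplace sign of column `j`.
          ≈⟨ *-congˡ (*-cong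
               (trans (reflexive (cong sign d+i≡q+j)) (^-homo-* (- 1#) (q j) (toℕ j)))
               (trans
                 (reflexive (cong (λ ss → Δ (arms ++ ss) id) (≡.sym (map-insertAt u (q j) S i))))
                 (Δ-giambelli (p ∘ suc) (q ∘ punchIn j) σ′))) ⟩
        w (q j) * (sign (q j) * sign (toℕ j) * D)
          ≈⟨ *-congˡ (trans (*-congʳ (*-comm _ _)) (*-assoc _ _ _)) ⟩
        w (q j) * (sign (toℕ j) * (sign (q j) * D))
          ≈⟨ x∙yz≈y∙xz _ _ _ ⟩
        sign (toℕ j) * (w (q j) * (sign (q j) * D))
          ≈⟨ *-congˡ (trans (sym (*-assoc _ _ _)) (*-congʳ (*-comm _ _))) ⟩
        sign (toℕ j) * (hookEntry v u (p zero) (q j) * D) ∎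
        where
        D : Carrier
        D = det R d (λ i k → hookEntry v u (p (suc i)) (q (punchIn j k)))

open YoungDiagram

-- Counting in initial segments and decreasing lists

module _ {p} {P : Pred ℕ p} (P? : Decidable P) where

  private
    count : (ℕ → ℕ) → ℕ → ℕ
    count f n = length (filter P? (applyUpTo f n))

  filter-applyUpTo-< : ∀ f n → (∀ i → P (f (suc i)) → P (f i)) → ∀ {i} → i < count f n → P (f i)
  filter-applyUpTo-< f (suc n) anti i< with P? (f 0)
  filter-applyUpTo-< f (suc n) anti {zero}  i<       | yes p0 = p0
  filter-applyUpTo-< f (suc n) anti {suc i} (s≤s i<) | yes p0 =
    filter-applyUpTo-< (f ∘ suc) n (anti ∘ suc) i<
  ... | no _ = anti _ (filter-applyUpTo-< (f ∘ suc) n (anti ∘ suc) i<)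

  -- Since `anti` makes the solutions of `P` along `f` an initial segment, a solution at index
  -- `count f n` shows that the segment does not end before `n`.
  filter-applyUpTo-end : ∀ f n → (∀ i → P (f (suc i)) → P (f i)) →
    P (f (count f n)) → n ≤ count f n
  filter-applyUpTo-end f zero    anti pf = z≤n
  filter-applyUpTo-end f (suc n) anti pf with P? (f 0)
  ... | yes _  = s≤s (filter-applyUpTo-end (f ∘ suc) n (anti ∘ suc) pf)
  ... | no ¬p0 = contradiction (first _ pf) ¬p0
    where
    first : ∀ m → P (f m) → P (f 0)
    first zero    pm = pm
    first (suc m) pm = first m (anti m pm)

count> : ℕ → List ℕ → ℕ
count> j xs = length (filter (j ℕ.<?_) xs)

count>-drop : ∀ d xs {j} → (∀ {i} → i < d → j < nth xs i) → count> j xs ≡ d ℕ.+ count> j (drop d xs)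
count>-drop zero    xs       big = ≡.refl
count>-drop (suc d) []       big = contradiction (big (s≤s z≤n)) ℕ.n≮0
count>-drop (suc d) (x ∷ xs) big = ≡.trans
  (cong length (filter-accept (_ ℕ.<?_) (big (s≤s z≤n))))
  (cong suc (count>-drop d xs (big ∘ s≤s)))

nth-drop : ∀ d xs i → nth (drop d xs) i ≡ nth xs (d ℕ.+ i)
nth-drop zero    xs       i = ≡.refl
nth-drop (suc d) []       i = ≡.refl
nth-drop (suc d) (x ∷ xs) i = nth-drop d xs i

nth-≤ : ∀ {b xs} → All (_≤ b) xs → ∀ i → nth xs i ≤ b
nth-≤ []       i       = z≤n
nth-≤ (p ∷ ps) zero    = p
nth-≤ (p ∷ ps) (suc i) = nth-≤ ps i

nth-length : ∀ xs → nth xs (length xs) ≡ 0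
nth-length []       = ≡.refl
nth-length (x ∷ xs) = nth-length xs

drop-decreasing : ∀ d {xs} → Linked _≥_ xs → Linked _≥_ (drop d xs)
drop-decreasing zero    l          = l
drop-decreasing (suc d) {[]}    l = []
drop-decreasing (suc d) {_ ∷ _} l = drop-decreasing d (Linked.tail l)

decreasing-bound : ∀ {b xs} → Linked _≥_ xs → nth xs 0 ≤ b → All (_≤ b) xs
decreasing-bound {xs = []}     l p = []
decreasing-bound {xs = x ∷ xs} l p = Linked⇒All (λ i≥j j≥k → ℕ.≤-trans j≥k i≥j) p l

nth-antitone : ∀ {xs} → Linked _≥_ xs → ∀ {i k} → i ≤ k → nth xs k ≤ nth xs i
nth-antitone {xs} l {i} i≤k with ℕ.m≤n⇒∃[o]m+o≡n i≤k
... | o , ≡.refl = ≡.subst (_≤ nth xs i) (nth-drop i xs o)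
  (nth-≤ (decreasing-bound (drop-decreasing i l)
    (ℕ.≤-reflexive (≡.trans (nth-drop i xs 0) (cong (nth xs) (ℕ.+-identityʳ i))))) o)

-- Rows and columns of a partition in a rectangle as complementary sets

gaps : ℕ → (ν : List ℕ) → Vec ℕ (length ν)
gaps t []      = []
gaps t (x ∷ ν) = t ∸ x ∷ gaps (suc t) ν

lookup-gaps : ∀ t ν i → lookup (gaps t ν) i ≡ t ℕ.+ toℕ i ∸ nth ν (toℕ i)
lookup-gaps t (x ∷ ν) zero    = cong (_∸ x) (≡.sym (ℕ.+-identityʳ t))
lookup-gaps t (x ∷ ν) (suc i) = ≡.trans (lookup-gaps (suc t) ν i)
  (cong (_∸ nth ν (toℕ i)) (≡.sym (ℕ.+-suc t (toℕ i))))

inject₁-equation : ∀ ν t (q : Fin (suc d) → ℕ) →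
  (∀ j → q j ℕ.+ suc (toℕ j) ≡ t ℕ.+ count> (toℕ j) ν) →
  ∀ j → q (inject₁ j) ℕ.+ suc (toℕ j) ≡ t ℕ.+ count> (toℕ j) ν
inject₁-equation ν t q q≡ j =
  ≡.subst (λ n → q (inject₁ j) ℕ.+ suc n ≡ t ℕ.+ count> n ν) (toℕ-inject₁ j) (q≡ (inject₁ j))

-- The last of the `suc d` columns is empty, so the equation for the last value of `q` makes it
-- `t - suc d`, which is `k`.
gaps-split-widen : ∀ {k} ν {t} → t ≡ k ℕ.+ suc d → All (_≤ d) ν → (q : Fin (suc d) → ℕ) →
  (∀ j → q j ℕ.+ suc (toℕ j) ≡ t ℕ.+ count> (toℕ j) ν) →
  Split (suc k) (q ∘ inject₁) (gaps t ν) → Split k q (gaps t ν)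
gaps-split-widen {d} {k} ν {t} t≡ ν≤d q q≡ = inQ (ℕ.+-cancelʳ-≡ (suc d) _ _ (begin
  q (fromℕ d) ℕ.+ suc d               ≡⟨ cong (λ n → q (fromℕ d) ℕ.+ suc n) (toℕ-fromℕ d) ⟨
  q (fromℕ d) ℕ.+ suc (toℕ (fromℕ d)) ≡⟨ q≡ (fromℕ d) ⟩
  t ℕ.+ count> (toℕ (fromℕ d)) ν      ≡⟨ cong (λ n → t ℕ.+ count> n ν) (toℕ-fromℕ d) ⟩
  t ℕ.+ count> d ν
    ≡⟨ cong (λ xs → t ℕ.+ length xs) (filter-none (d ℕ.<?_) (All.map ℕ.≤⇒≯ ν≤d)) ⟩
  t ℕ.+ 0                             ≡⟨ ℕ.+-identityʳ t ⟩
  t                                   ≡⟨ t≡ ⟩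
  k ℕ.+ suc d                         ∎))
  where open ≡.≡-Reasoning

-- For a partition ν contained in a rectangle of width d, the numbers
-- d + i - ν_i and d - 1 - j + ν′_j (counted from 0) are complementary.
gaps-split : ∀ {k} d ν {t} → t ≡ k ℕ.+ d → Linked _≥_ ν → All (_≤ d) ν → (q : Fin d → ℕ) →
  (∀ j → q j ℕ.+ suc (toℕ j) ≡ t ℕ.+ count> (toℕ j) ν) → Split k q (gaps t ν)
gaps-split zero [] t≡ l ν≤d q q≡ = none
gaps-split {k} (suc d) [] {t} t≡ l ν≤d q q≡ = gaps-split-widen [] t≡ [] q q≡
  (gaps-split d [] (≡.trans t≡ (ℕ.+-suc k d)) l [] (q ∘ inject₁) (inject₁-equation [] t q q≡))
-- Follow the boundary of the partition: a first row of full length puts `k` into `S`; otherwise the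
-- last column is empty and `k` is a value of `q`.
gaps-split {k} d (x ∷ ν) {t} t≡ l (x≤d ∷ ν≤d) q q≡ with x ℕ.≟ d
gaps-split {k} d (_ ∷ ν) {t} t≡ l (x≤d ∷ ν≤d) q q≡ | yes ≡.refl =
  ≡.subst (λ m → Split k q (m ∷ gaps (suc t) ν))
    (≡.sym (≡.trans (cong (_∸ d) t≡) (ℕ.m+n∸n≡m k d)))
    (inS (gaps-split d ν (cong suc t≡) (Linked.tail l) ν≤d q λ j → ≡.trans (q≡ j)
      (≡.trans (cong (λ xs → t ℕ.+ length xs) (filter-accept (toℕ j ℕ.<?_) (toℕ<n j)))
        (ℕ.+-suc t _))))
gaps-split zero (x ∷ ν) t≡ l (x≤d ∷ ν≤d) q q≡ | no x≢d = contradiction (ℕ.n≤0⇒n≡0 x≤d) x≢d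
gaps-split {k} (suc d) (x ∷ ν) {t} t≡ l (x≤d ∷ ν≤d) q q≡ | no x≢d =
  gaps-split-widen (x ∷ ν) t≡ bound q q≡
    (gaps-split d (x ∷ ν) (≡.trans t≡ (ℕ.+-suc k d)) l bound (q ∘ inject₁)
      (inject₁-equation (x ∷ ν) t q q≡))
  where
  bound : All (_≤ d) (x ∷ ν)
  bound = decreasing-bound l (ℕ.≤-pred (ℕ.≤∧≢⇒< x≤d x≢d))

lookup-++-toℕ : ∀ {A : Set c} (xs : Vec A d) (ys : Vec A e) (f : ℕ → A) →
  (∀ i → lookup xs i ≡ f (toℕ i)) → (∀ i → lookup ys i ≡ f (d ℕ.+ toℕ i)) →
  ∀ i → lookup (xs ++ ys) i ≡ f (toℕ i)
lookup-++-toℕ []       ys f p q i       = q i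
lookup-++-toℕ (x ∷ xs) ys f p q zero    = p zero
lookup-++-toℕ (x ∷ xs) ys f p q (suc i) = lookup-++-toℕ xs ys (f ∘ suc) (p ∘ suc) q i

-- The Durfee square and the Frobenius coordinates

diagonal-≤ : ∀ μ → diagonal μ ≤ depth μ
diagonal-≤ μ = ≡.subst (diagonal μ ≤_) (length-upTo (depth μ))
  (length-filter (λ i → i ℕ.<? row μ i) (upTo (depth μ)))

row-antitone : ∀ μ {i k} → i ≤ k → row μ k ≤ row μ i
row-antitone μ = nth-antitone (decreasing μ)

diagonal-antitone : ∀ μ i → suc i < row μ (suc i) → i < row μ i
diagonal-antitone μ i i< = ℕ.<-≤-trans (ℕ.<-trans (ℕ.n<1+n i) i<) (row-antitone μ (ℕ.n≤1+n i))

row-diagonal-> : ∀ μ {i} → i < diagonal μ → diagonal μ ≤ row μ i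
row-diagonal-> μ {i} i<d
  with diagonal μ
     | filter-applyUpTo-< (λ i → i ℕ.<? row μ i) id (depth μ) (diagonal-antitone μ)
row-diagonal-> μ {i} (s≤s i≤d) | suc d | diag = ℕ.≤-trans (diag (ℕ.n<1+n d)) (row-antitone μ i≤d)

-- A longer row would continue the diagonal, so the count could have stopped only at `depth μ`, from
-- where on the rows have length 0.
row-diagonal-≤ : ∀ μ → row μ (diagonal μ) ≤ diagonal μ
row-diagonal-≤ μ = ℕ.≮⇒≥ λ d<row →
  ℕ.n≮0 (ℕ.<-≤-trans d<row (ℕ.≤-trans
    (row-antitone μ
      (filter-applyUpTo-end (λ i → i ℕ.<? row μ i) id (depth μ) (diagonal-antitone μ) d<row))
    (ℕ.≤-reflexive (nth-length (rows μ)))))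

beyondDiagonal-≤ : ∀ μ → All (_≤ diagonal μ) (drop (diagonal μ) (rows μ))
beyondDiagonal-≤ μ = decreasing-bound (drop-decreasing (diagonal μ) (decreasing μ))
  (ℕ.≤-trans (ℕ.≤-reflexive (≡.trans (nth-drop (diagonal μ) (rows μ) 0)
      (cong (row μ) (ℕ.+-identityʳ (diagonal μ)))))
    (row-diagonal-≤ μ))

arm-row : ∀ μ i → arm μ i ℕ.+ suc (toℕ i) ≡ row μ (toℕ i)
arm-row μ i = ℕ.m∸n+n≡m (ℕ.≤-trans (toℕ<n i) (row-diagonal-> μ (toℕ<n i)))

-- Each of these columns runs through the whole Durfee square; the rest of it is a column of the
-- partition below the square, as `gaps-split` expects.
leg-column : ∀ μ j →
  leg μ j ℕ.+ suc (toℕ j) ≡ diagonal μ ℕ.+ count> (toℕ j) (drop (diagonal μ) (rows μ))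
leg-column μ j = ≡.trans
  (ℕ.m∸n+n≡m (ℕ.≤-trans (toℕ<n j)
    (≡.subst (diagonal μ ≤_) (≡.sym column≡) (ℕ.m≤m+n (diagonal μ) _))))
  column≡
  where
  column≡ : column μ (toℕ j) ≡ diagonal μ ℕ.+ count> (toℕ j) (drop (diagonal μ) (rows μ))
  column≡ = count>-drop (diagonal μ) (rows μ) λ i<d → ℕ.<-≤-trans (toℕ<n j) (row-diagonal-> μ i<d)

-- The Giambelli formula for determinants of Jacobi-Trudi shape

module _ (R : CommutativeRing c ℓ) where

  open CommutativeRing R hiding (zero)
  open Expansion R
  open import Relation.Binary.Reasoning.Setoid setoid

  -- Only the shape of the Jacobi–Trudi rows matters: the row of index r is
  -- zero in the columns before -r and one in column -r.
  module _ (g : ℤ → ℕ → Carrier) (below : ∀ {m j} → j < m → g (ℤ.- + m) j ≈ 0#)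
    (unit : ∀ m → g (ℤ.- + m) m ≈ 1#) (schur : YoungDiagram → Carrier)
    (schur-det : ∀ μ →
      schur μ ≈ det R (depth μ) (λ i j → g (+ row μ (toℕ i) ℤ.- + toℕ i) (toℕ j))) where

    v u : ℕ → Row
    v p = g (+ suc p)
    u m = g (ℤ.- + m)

    -- Stated for any `d`, `p` and `q` that satisfy the Frobenius equations, so that a hook is
    -- treated with `d = 1` directly, without evaluating its `diagonal`, `arm` and `leg`.
    schur-hookEntries : ∀ μ → d ≤ depth μ → All (_≤ d) (drop d (rows μ)) →
      (p q : Fin d → ℕ) → (∀ i → p i ℕ.+ suc (toℕ i) ≡ row μ (toℕ i)) →
      (∀ j → q j ℕ.+ suc (toℕ j) ≡ d ℕ.+ count> (toℕ j) (drop d (rows μ))) →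
      schur μ ≈ det R d (λ i j → hookEntry v u (p i) (q j))
    schur-hookEntries {d} μ d≤ ν≤d p q p≡ q≡ = begin
      schur μ
        ≈⟨ schur-det μ ⟩
      det R (depth μ) (λ i j → rowAt (toℕ i) (toℕ j))
        ≡⟨ cong (λ n → det R n λ i j → rowAt (toℕ i) (toℕ j))
             (≡.trans (cong (d ℕ.+_) (length-drop d (rows μ))) (ℕ.m+[n∸m]≡n d≤)) ⟨
      det R (d ℕ.+ length ν) (λ i j → rowAt (toℕ i) (toℕ j))
        ≈⟨ det-cong R (d ℕ.+ length ν) (λ i j → reflexive (cong (λ r → r (toℕ j))
             (lookup-++-toℕ arms (Vec.map u S) rowAt lookup-arms lookup-gap i))) ⟨
      det R (d ℕ.+ length ν) (λ i j → lookup (arms ++ Vec.map u S) i (toℕ j))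
        ≈⟨ Δ-det (arms ++ Vec.map u S) id ⟨
      Δ (arms ++ Vec.map u S) id
        ≈⟨ Δ-giambelli v u below unit p q
             (gaps-split d ν ≡.refl (drop-decreasing d (decreasing μ)) ν≤d q q≡) ⟩
      det R d (λ i j → hookEntry v u (p i) (q j)) ∎
      where
      ν : List ℕ
      ν = drop d (rows μ)

      S : Vec ℕ (length ν)
      S = gaps d ν

      arms : Vec Row d
      arms = tabulate (v ∘ p)

      rowAt : ℕ → Row
      rowAt i = g (+ row μ i ℤ.- + i)

      arm-index : ∀ a i → + suc a ≡ + (a ℕ.+ suc i) ℤ.- + i
      arm-index a i = ≡.sym (≡.trans (ℤ.m-n≡m⊖n (a ℕ.+ suc i) i)
        (≡.trans (cong (ℤ._⊖ i) (ℕ.+-suc a i))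
          (≡.trans (ℤ.⊖-≥ (ℕ.m≤n+m i (suc a))) (cong +_ (ℕ.m+n∸n≡m (suc a) i)))))

      lookup-arms : ∀ i → lookup arms i ≡ rowAt (toℕ i)
      lookup-arms i = ≡.trans (lookup∘tabulate (v ∘ p) i) (cong g
        (≡.trans (arm-index (p i) (toℕ i)) (cong (λ r → + r ℤ.- + toℕ i) (p≡ i))))

      -- A gap is minus the index of a row after the first `d`; the truncated subtraction is exact
      -- because the rows of `ν` have length at most `d`.
      lookup-gap : ∀ i → lookup (Vec.map u S) i ≡ rowAt (d ℕ.+ toℕ i)
      lookup-gap i = ≡.trans (lookup-map i u S) (cong g (≡.trans
        (cong (λ m → ℤ.- + m) (≡.trans (lookup-gaps d ν i)
          (cong (d ℕ.+ toℕ i ∸_) (nth-drop d (rows μ) (toℕ i)))))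
        (≡.sym (≡.trans (ℤ.m-n≡m⊖n _ (d ℕ.+ toℕ i)) (ℤ.⊖-≤ (ℕ.≤-trans
          (≡.subst (_≤ d) (nth-drop d (rows μ) (toℕ i)) (nth-≤ ν≤d (toℕ i)))
          (ℕ.m≤m+n d (toℕ i))))))))

    schur-hook : ∀ p q → schur (hook p q) ≈ hookEntry v u p q
    schur-hook p q = begin
      schur (hook p q)
        ≈⟨ schur-hookEntries {1} (hook p q) (s≤s z≤n) (All.replicate⁺ q (s≤s z≤n))
             (λ _ → p) (λ _ → q)
             (λ { zero → ℕ.+-comm p 1 })
             (λ { zero → ≡.trans (ℕ.+-comm q 1) (cong suc (≡.sym (≡.trans
               (cong length (filter-all (0 ℕ.<?_) (All.replicate⁺ q (s≤s z≤n))))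
               (length-replicate q)))) }) ⟩
      1# * (hookEntry v u p q * 1#) + 0#  ≈⟨ +-identityʳ _ ⟩
      1# * (hookEntry v u p q * 1#)       ≈⟨ *-identityˡ _ ⟩
      hookEntry v u p q * 1#              ≈⟨ *-identityʳ _ ⟩
      hookEntry v u p q                   ∎

    schur-giambelli : ∀ μ →
      schur μ ≈ det R (diagonal μ) (λ i j → schur (hook (arm μ i) (leg μ j)))
    schur-giambelli μ = trans
      (schur-hookEntries μ (diagonal-≤ μ) (beyondDiagonal-≤ μ) (arm μ) (leg μ)
        (arm-row μ) (leg-column μ))
      (sym (det-cong R (diagonal μ) λ i j → schur-hook (arm μ i) (leg μ j)))

theorem5 : ∀ {c ℓ} (K : CommutativeRing c ℓ) (a : ℤ → CommutativeRing.Carrier K) (μ : YoungDiagram) →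
    CommutativeRing._≈_ (Λ K)
    (s K a μ)
    (det (Λ K) (diagonal μ) (λ i j → s K a (hook (arm μ i) (leg μ j))))
theorem5 {c} {ℓ} K a = schur-giambelli (Λ K) g below unit (s K a) (λ μ → refl {s K a μ})
  where
  open CommutativeRing (Λ K) using (Carrier; _≈_; 0#; 1#; refl; reflexive)

  -- The shift of `a` depends on the column `j` alone, so an entry depends on its row only through
  -- the index `r`, and all diagrams draw their rows from one family.
  g : ℤ → ℕ → Carrier
  g r j = h K (r ℤ.+ + j) (shift (ℤ.- + j) a)

  h-negative : ∀ {r} b → r ℤ.< + 0 → h K r b ≈ 0#
  h-negative {+ _}       b (ℤ.+<+ ())
  h-negative { -[1+ _ ]} b _ = refl {0#}

  below : ∀ {m j} → j < m → g (ℤ.- + m) j ≈ 0#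
  below {m} {j} j<m = h-negative _ (≡.subst (ℤ.- + m ℤ.+ + j ℤ.<_)
    (ℤ.+-inverseˡ (+ m)) (ℤ.+-monoʳ-< (ℤ.- + m) (ℤ.+<+ j<m)))

  unit : ∀ m → g (ℤ.- + m) m ≈ 1#
  unit m = reflexive (cong (λ r → h K r (shift (ℤ.- + m) a)) (ℤ.+-inverseˡ (+ m)))
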